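{- Let $n,k$ be integers with $1\le k<\lfloor n/2\rfloor$, $n$ even, and $(2k+1)\mid n$, and let $G=C_n^k$ be the corresponding power of cycle graph. Then the equitable total chromatic number of $G$ equals its total chromatic number, i.e. $\chi''_{=}(G)=\chi''(G)$. Further, $\chi''_{\Sigma}(G)\le 2k+3=\Delta(G)+3$.
   Context: All graphs are finite, simple and undirected. A total coloring of a graph $G$ is a coloring of the vertices and edges of $G$ such that no two adjacent vertices, no two adjacent edges, and no edge and a vertex incident with it receive the same color. The total chromatic number $\chi''(G)$ is the minimum number of colors in a total coloring of $G$, and $\Delta(G)$ is the maximum degree. An equitable total coloring is a total coloring in which the sizes of any two color classes (each class consisting of all vertices and edges of a given color) differ by at most one; the equitable total chromatic number $\chi''_{=}(G)$ is the minimum number of colors in an equitable total coloring. A total $k$-coloring $c$ of $G$ with colors $1,\ldots,k$ is neighborhood sum distinguishing if $\sum_c(u)\ne\sum_c(v)$ for every edge $uv$, where $\sum_c(u)$ is the sum of the color of the vertex $u$ and the colors of all edges incident with $u$; $\chi''_{\Sigma}(G)$ is the minimum number of colors $k$ for which such a coloring exists. For integers $1\le k<\lfloor n/2\rfloor$, the power of cycle $C_n^k$ is the graph with vertex set $\mathbb{Z}_n$ in which distinct $x,y$ are adjacent if and only if $x-y\in\{\pm1,\pm2,\ldots,\pm k\}$ modulo $n$. -}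

module Defs where

open import Level using (0ℓ)
open import Data.Nat using (ℕ; suc; _+_; _≤_)
open import Data.Fin using (Fin; toℕ; _<?_)
open import Data.Fin.Properties using (_≟_; any?)
open import Data.Integer as ℤ using (ℤ; +_)
import Data.Integer.Properties as ℤ
import Data.Integer.Divisibility as ℤ
open import Data.Integer.Tactic.RingSolver using (solve-∀)
import Data.Nat.Divisibility as ℕ
open import Data.Nat.ListAction using (sum)
open import Data.List using (List; allFin; cartesianProduct; filter; length; map)
open import Data.List.Extrema.Nat using (max)
open import Data.Product using (Σ-syntax; ∃-syntax; _×_; _,_)
open import Data.Sum using (_⊎_; inj₁; inj₂)
open import Relation.Binary using (Rel; Decidable; Symmetric; Irreflexive)
open import Relation.Binary.PropositionalEquality
open import Relation.Nullary using (¬?; _×-dec_; _⊎-dec_)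

record Graph (n : ℕ) : Set₁ where
  field
    Adj    : Rel (Fin n) 0ℓ
    adj?   : Decidable Adj
    symm   : Symmetric Adj
    irrefl : Irreflexive _≡_ Adj

  neighbours : Fin n → List (Fin n)
  neighbours u = filter (adj? u) (allFin n)

  degree : Fin n → ℕ
  degree u = length (neighbours u)

  -- Each edge {u , v} is listed once, as the pair with u < v.
  edges : List (Fin n × Fin n)
  edges = filter (λ (u , v) → (u <? v) ×-dec adj? u v)
                 (cartesianProduct (allFin n) (allFin n))

-- The default value 0 matters only for the graph without vertices.
Δ : ∀ {n} → Graph n → ℕ
Δ {n} G = max 0 (map (Graph.degree G) (allFin n))

-- A total colouring with (at most) m colours.  The colour of the edge {u , v}
-- is edge u v; the values of edge at non-adjacent pairs carry no information
-- and are never used.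
record TotalColouring {n : ℕ} (G : Graph n) (m : ℕ) : Set where
  open Graph G
  field
    vertex        : Fin n → Fin m
    edge          : Fin n → Fin n → Fin m
    edge-sym      : ∀ {u v} → Adj u v → edge u v ≡ edge v u
    vertex≢vertex : ∀ {u v} → Adj u v → vertex u ≢ vertex v
    edge≢edge     : ∀ {u v w} → Adj u v → Adj u w → v ≢ w → edge u v ≢ edge u w
    vertex≢edge   : ∀ {u v} → Adj u v → vertex u ≢ edge u v

  classSize : Fin m → ℕ
  classSize c = length (filter (λ u → vertex u ≟ c) (allFin n))
              + length (filter (λ (u , v) → edge u v ≟ c) edges)

  -- The element i of Fin m stands for the colour i + 1, so that the colours
  -- are 1 , … , m; this matters for the sums below.
  value : Fin m → ℕ
  value c = suc (toℕ c)

  colourSum : Fin n → ℕ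
  colourSum u = value (vertex u) + sum (map (λ v → value (edge u v)) (neighbours u))

  Equitable : Set
  Equitable = ∀ c d → classSize c ≤ suc (classSize d)

  NeighbourSumDistinguishing : Set
  NeighbourSumDistinguishing = ∀ {u v} → Adj u v → colourSum u ≢ colourSum v

IsLeast : (ℕ → Set) → ℕ → Set
IsLeast P m = P m × (∀ j → P j → m ≤ j)

-- χ″(G) = m, χ″₌(G) = m and χ″_Σ(G) = m respectively.
module _ {n : ℕ} (G : Graph n) where
  open TotalColouring

  IsTotalChromaticNumber : ℕ → Set
  IsTotalChromaticNumber = IsLeast (TotalColouring G)

  IsEquitableTotalChromaticNumber : ℕ → Set
  IsEquitableTotalChromaticNumber =
    IsLeast (λ m → Σ[ c ∈ TotalColouring G m ] Equitable c)

  IsSumDistinguishingTotalChromaticNumber : ℕ → Set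
  IsSumDistinguishingTotalChromaticNumber =
    IsLeast (λ m → Σ[ c ∈ TotalColouring G m ] NeighbourSumDistinguishing c)

-- Fin n represents ℤ/n.  The index i : Fin k stands for the step i + 1, so
-- the second component says that x - y is one of ±1 , … , ±k modulo n.
CyclePowerAdj : (n k : ℕ) → Rel (Fin n) 0ℓ
CyclePowerAdj n k x y = x ≢ y × ∃[ i ] Step i
  where
  difference : ℤ
  difference = + toℕ x ℤ.- + toℕ y

  Step : Fin k → Set
  Step i = (+ n ℤ.∣ difference ℤ.- + suc (toℕ i))
         ⊎ (+ n ℤ.∣ difference ℤ.+ + suc (toℕ i))

cyclePower : (n k : ℕ) → Graph n
cyclePower n k = record
  { Adj    = CyclePowerAdj n k
  ; adj?   = λ x y → ¬? (x ≟ y) ×-dec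
                     any? (λ i → (n ℕ.∣? _) ⊎-dec (n ℕ.∣? _))
  ; symm   = symm
  ; irrefl = λ { refl (x≢x , _) → x≢x refl }
  }
  where
  negate : ∀ a b c → ℤ.- (a ℤ.- b ℤ.- c) ≡ b ℤ.- a ℤ.+ c
  negate = solve-∀

  swap : ∀ a b c → ℤ.∣ a ℤ.- b ℤ.- c ∣ ≡ ℤ.∣ b ℤ.- a ℤ.+ c ∣
  swap a b c = trans (sym (ℤ.∣-i∣≡∣i∣ (a ℤ.- b ℤ.- c))) (cong ℤ.∣_∣ (negate a b c))

  symm : Symmetric (CyclePowerAdj n k)
  symm {x} {y} (x≢y , i , inj₁ p) =
    (λ e → x≢y (sym e)) , i , inj₂ (subst (n ℕ.∣_) (swap (+ toℕ x) (+ toℕ y) _) p)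
  symm {x} {y} (x≢y , i , inj₂ p) =
    (λ e → x≢y (sym e)) , i , inj₁ (subst (n ℕ.∣_) (sym (swap (+ toℕ y) (+ toℕ x) _)) p)

{-# OPTIONS --safe #-}

-- Put q = 2k + 1.  Since q divides n, residues modulo q make sense on ℤ/n, and the
-- closed neighbourhood of each vertex is a complete system of residues.  Hence
-- colouring the vertex x with 2x and the edge xy with x + y modulo q is a total
-- colouring in which every vertex sees all q = Δ + 1 colours.  The rotation by s
-- adds 2s to all colours, and 2 is invertible modulo q, so all classes have the
-- same size.
--
-- All colour sums of this colouring are equal.  As n is even, the Hamiltonian cycle
-- of edges {x , x + 1} can be recoloured alternately with two new colours.  The
-- colour sum of x then changes by a constant minus the sum of the two removed
-- colours, and the latter is (2x + 1) + (2x - 1) = 4x modulo q, which separates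
-- adjacent vertices.
module Submission where

open import Data.Nat using (ℕ; zero; suc; _+_; _*_; _^_; _≤_; _<_; ⌊_/2⌋; z≤n; s≤s; NonZero; >-nonZero)
open import Data.Nat.Divisibility using (_∣_; ∣⇒≤)
open import Data.Product using (∃; ∃-syntax; Σ-syntax; _×_; _,_; proj₁; proj₂)
open import Relation.Binary.PropositionalEquality using
  (_≡_; _≢_; _≗_; refl; sym; trans; cong; cong₂; subst; subst₂; setoid; module ≡-Reasoning)
open import Defs

import Data.Nat.Properties as ℕ
import Data.Nat.Tactic.RingSolver as ℕ
open import Data.Nat.ListAction using (sum)
open import Data.Nat.ListAction.Properties using (sum-↭)
open import Data.Integer as ℤ using (ℤ; +_; -[1+_]; ∣_∣)
import Data.Integer.Properties as ℤ
import Data.Integer.DivMod as ℤ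
import Data.Integer.Divisibility.Signed as ℤ
open import Data.Integer.Tactic.RingSolver using (solve-∀)
open import Data.Fin using (Fin; toℕ; fromℕ<; zero; suc; _↑ˡ_; _↑ʳ_; finToFun; funToFin)
import Data.Fin as Fin
open import Data.Fin.Properties using
  (_≟_; any?; all?; toℕ<n; toℕ-fromℕ<; toℕ-injective; toℕ-↑ˡ; toℕ-↑ʳ;
   ↑ˡ-injective; ↑ʳ-injective; finToFun-funToFin; <-cmp)
open import Data.List using (List; []; _∷_; _++_; map; length; filter; allFin; cartesianProduct)
open import Data.List.Properties using
  (length-map; length-tabulate; map-cong; map-cong-local; map-∘)
open import Data.List.Extrema.Nat using (max≤v⁺; v≤max⁺)
open import Data.List.Membership.Propositional using (_∈_)
open import Data.List.Membership.Propositional.Properties using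
  (∈-∃++; ∈-allFin; ∈-filter⁺; ∈-filter⁻; ∈-map⁺; ∈-map⁻; ∈-cartesianProduct⁺)
open import Data.List.Membership.Propositional.Properties.WithK using (unique∧set⇒bag)
open import Data.List.Relation.Binary.BagAndSetEquality using (∼bag⇒↭)
open import Data.List.Relation.Binary.Permutation.Propositional using (_↭_; ↭-trans; prep; ↭⇒↭ₛ)
open import Data.List.Relation.Binary.Permutation.Propositional.Properties using (shift; ↭-length; ∈-resp-↭)
import Data.List.Relation.Binary.Permutation.Propositional.Properties as ↭
import Data.List.Relation.Binary.Permutation.Setoid.Properties as ↭ₛ
open import Data.List.Relation.Unary.All as All using (All; []; _∷_)
import Data.List.Relation.Unary.All.Properties as All
open import Data.List.Relation.Unary.AllPairs using ([]; _∷_)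
open import Data.List.Relation.Unary.Any as Any using (here; there)
import Data.List.Relation.Unary.Any.Properties as Any
open import Data.List.Relation.Unary.Unique.Propositional using (Unique)
open import Data.List.Relation.Unary.Unique.Propositional.Properties using
  (allFin⁺; filter⁺; cartesianProduct⁺; Unique[x∷xs]⇒x∉xs)
open import Data.Sum using (_⊎_; inj₁; inj₂)
open import Function using (_∘_; mk⇔)
open import Relation.Binary using (tri<; tri≈; tri>)
open import Relation.Nullary using (Dec; yes; no; ¬?; contradiction; _×-dec_; _→-dec_)
open import Relation.Nullary.Decidable using (map′)
open import Relation.Unary using (Decidable)

-- Lists without repetition

module _ {A : Set} where

  ∈⇒↭∷ : ∀ {x : A} {xs} → x ∈ xs → ∃[ ys ] xs ↭ x ∷ ys
  ∈⇒↭∷ x∈xs with ys , zs , refl ← ∈-∃++ x∈xs = ys ++ zs , shift _ ys zs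

  Unique-resp-↭ : ∀ {xs ys : List A} → xs ↭ ys → Unique xs → Unique ys
  Unique-resp-↭ p = ↭ₛ.Unique-resp-↭ (setoid A) (↭⇒↭ₛ p)

  unique⇒↭ : ∀ {xs ys : List A} → Unique xs → Unique ys →
             (∀ {x} → x ∈ xs → x ∈ ys) → (∀ {x} → x ∈ ys → x ∈ xs) → xs ↭ ys
  unique⇒↭ uxs uys to from = ∼bag⇒↭ (unique∧set⇒bag uxs uys (mk⇔ to from))

  unique-⊆⇒length≤ : ∀ {xs ys : List A} → Unique xs →
                     (∀ {x} → x ∈ xs → x ∈ ys) → length xs ≤ length ys
  unique-⊆⇒length≤ {[]}     _           _     = z≤n
  unique-⊆⇒length≤ {x ∷ xs} {ys} u@(_ ∷ uxs) xs⊆ys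
    with zs , ys↭x∷zs ← ∈⇒↭∷ (xs⊆ys (here refl)) =
    subst (suc (length xs) ≤_) (sym (↭-length ys↭x∷zs)) (s≤s (unique-⊆⇒length≤ uxs xs⊆zs))
    where
    xs⊆zs : ∀ {y} → y ∈ xs → y ∈ zs
    xs⊆zs y∈xs with ∈-resp-↭ ys↭x∷zs (xs⊆ys (there y∈xs))
    ... | here refl  = contradiction y∈xs (Unique[x∷xs]⇒x∉xs u)
    ... | there y∈zs = y∈zs

module _ {A B : Set} {f : A → B} where

  map-unique : ∀ {xs} → (∀ {x y} → x ∈ xs → y ∈ xs → f x ≡ f y → x ≡ y) →
               Unique xs → Unique (map f xs)
  map-unique {[]}     _   _              = []
  map-unique {x ∷ xs} inj (x∉xs ∷ uxs) =
    All.map⁺ (All.tabulate (λ y∈xs fx≡fy →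
      All.lookup x∉xs y∈xs (inj (here refl) (there y∈xs) fx≡fy)))
    ∷ map-unique (λ p q → inj (there p) (there q)) uxs

  injection⇒length≤ : ∀ {xs ys} → Unique xs → (∀ {x} → x ∈ xs → f x ∈ ys) →
                      (∀ {x y} → x ∈ xs → y ∈ xs → f x ≡ f y → x ≡ y) →
                      length xs ≤ length ys
  injection⇒length≤ {xs} {ys} uxs f∈ inj =
    subst (_≤ length ys) (length-map f xs) (unique-⊆⇒length≤ (map-unique inj uxs) image)
    where
    image : ∀ {y} → y ∈ map f xs → y ∈ ys
    image y∈ with x , x∈xs , refl ← ∈-map⁻ f y∈ = f∈ x∈xs

-- Least elements and finite search

module _ {P : ℕ → Set} (P? : Decidable P) where

  -- The second alternative, failure of `P` below `m`, is the minimality half of `IsLeast P m`, so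
  -- the first success met in an upward search is least.
  least-below : ∀ m → (∃[ s ] (IsLeast P s × s < m)) ⊎ (∀ j → P j → m ≤ j)
  least-below zero = inj₂ (λ _ _ → z≤n)
  least-below (suc m) with least-below m
  ... | inj₁ (s , least , s<m) = inj₁ (s , least , ℕ.m≤n⇒m≤1+n s<m)
  ... | inj₂ m≤ with P? m
  ...   | yes p = inj₁ (m , (p , m≤) , ℕ.≤-refl)
  ...   | no ¬p = inj₂ (λ j pj → ℕ.≤∧≢⇒< (m≤ j pj) (λ { refl → ¬p pj }))

  least : ∀ {m} → P m → ∃[ s ] (IsLeast P s × s ≤ m)
  least {m} pm with least-below (suc m)
  ... | inj₁ (s , isLeast , s≤s s≤m) = s , isLeast , s≤m
  ... | inj₂ m<                      = contradiction (m< m pm) (ℕ.<-irrefl refl)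

module _ {n : ℕ} (G : Graph n) (m : ℕ) where
  open Graph G

  module _ (vertex : Fin n → Fin m) (edge : Fin n → Fin n → Fin m) where

    total : Fin n → ℕ
    total u = suc (toℕ (vertex u)) + sum (map (λ v → suc (toℕ (edge u v))) (neighbours u))

    -- A plain conjunction with explicit arguments, so that each clause can be decided by running
    -- through the finitely many vertices.
    IsDistinguishing : Set
    IsDistinguishing =
        (∀ u v → Adj u v → edge u v ≡ edge v u)
      × (∀ u v → Adj u v → vertex u ≢ vertex v)
      × (∀ u v w → Adj u v → Adj u w → v ≢ w → edge u v ≢ edge u w)
      × (∀ u v → Adj u v → vertex u ≢ edge u v)
      × (∀ u v → Adj u v → total u ≢ total v)

    isDistinguishing? : Dec IsDistinguishing
    isDistinguishing? =
            all? (λ u → all? λ v → adj? u v →-dec edge u v ≟ edge v u)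
      ×-dec all? (λ u → all? λ v → adj? u v →-dec ¬? (vertex u ≟ vertex v))
      ×-dec all? (λ u → all? λ v → all? λ w → adj? u v →-dec adj? u w →-dec
                    ¬? (v ≟ w) →-dec ¬? (edge u v ≟ edge u w))
      ×-dec all? (λ u → all? λ v → adj? u v →-dec ¬? (vertex u ≟ edge u v))
      ×-dec all? (λ u → all? λ v → adj? u v →-dec ¬? (total u ℕ.≟ total v))

  -- Decoding an encoded function recovers it only pointwise, so the property has to be carried
  -- along pointwise equality.
  isDistinguishing-resp : ∀ {f f′ g g′} → f ≗ f′ → (∀ u v → g u v ≡ g′ u v) →
                          IsDistinguishing f g → IsDistinguishing f′ g′
  isDistinguishing-resp {f} {f′} {g} {g′} f≗ g≗ (a , b , c , d , e) =
      (λ u v p → subst₂ _≡_ (g≗ u v) (g≗ v u) (a u v p))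
    , (λ u v p → subst₂ _≢_ (f≗ u) (f≗ v) (b u v p))
    , (λ u v w p q v≢w → subst₂ _≢_ (g≗ u v) (g≗ u w) (c u v w p q v≢w))
    , (λ u v p → subst₂ _≢_ (f≗ u) (g≗ u v) (d u v p))
    , (λ u v p → subst₂ _≢_ (total≗ u) (total≗ v) (e u v p))
    where
    total≗ : ∀ u → total f g u ≡ total f′ g′ u
    total≗ u = cong₂ (λ x xs → suc (toℕ x) + sum xs) (f≗ u)
                     (map-cong (λ v → cong (suc ∘ toℕ) (g≗ u v)) (neighbours u))

  -- Colour functions on vertices and on pairs are coded by elements of `Fin (m ^ n)` and
  -- `Fin ((m ^ n) ^ n)`, which makes existence a finite search.
  distinguishing? : Dec (Σ[ c ∈ TotalColouring G m ] TotalColouring.NeighbourSumDistinguishing c)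
  distinguishing? = map′ to from
    (any? λ i → any? λ j → isDistinguishing? (decodeVertex i) (decodeEdge j))
    where
    decodeVertex : Fin (m ^ n) → Fin n → Fin m
    decodeVertex = finToFun

    decodeEdge : Fin ((m ^ n) ^ n) → Fin n → Fin n → Fin m
    decodeEdge j u = finToFun (finToFun j u)

    to : (∃[ i ] ∃[ j ] IsDistinguishing (decodeVertex i) (decodeEdge j)) →
         Σ[ c ∈ TotalColouring G m ] TotalColouring.NeighbourSumDistinguishing c
    to (i , j , a , b , c , d , e) = record
      { vertex        = decodeVertex i
      ; edge          = decodeEdge j
      ; edge-sym      = a _ _
      ; vertex≢vertex = b _ _
      ; edge≢edge     = c _ _ _
      ; vertex≢edge   = d _ _
      } , e _ _

    from : Σ[ c ∈ TotalColouring G m ] TotalColouring.NeighbourSumDistinguishing c →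
           ∃[ i ] ∃[ j ] IsDistinguishing (decodeVertex i) (decodeEdge j)
    from (c , distinguishing) =
      funToFin vertex , funToFin (λ u → funToFin (edge u)) ,
      isDistinguishing-resp
        (λ u → sym (finToFun-funToFin vertex u))
        (λ u v → sym (trans
          (cong (λ i → finToFun i v) (finToFun-funToFin (λ u → funToFin (edge u)) u))
          (finToFun-funToFin (edge u) v)))
        ( (λ _ _ → edge-sym) , (λ _ _ → vertex≢vertex) , (λ _ _ _ → edge≢edge)
        , (λ _ _ → vertex≢edge) , (λ _ _ → distinguishing))
      where open TotalColouring c

-- A closed neighbourhood is coloured injectively.
totalColouring⇒degree< : ∀ {n m} {G : Graph n} → TotalColouring G m →
                         ∀ u → Graph.degree G u < m
totalColouring⇒degree< {n} {m} {G} c u =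
  subst₂ _≤_ (cong suc (length-map (edge u) (neighbours u))) (length-tabulate {n = m} (λ i → i))
    (unique-⊆⇒length≤ colours-unique (λ {i} _ → ∈-allFin i))
  where
  open Graph G
  open TotalColouring c

  adj : ∀ {v} → v ∈ neighbours u → Adj u v
  adj v∈ = proj₂ (∈-filter⁻ (adj? u) {xs = allFin n} v∈)

  edge-injective : ∀ {v w} → v ∈ neighbours u → w ∈ neighbours u → edge u v ≡ edge u w → v ≡ w
  edge-injective {v} {w} v∈ w∈ eq with v ≟ w
  ... | yes v≡w = v≡w
  ... | no  v≢w = contradiction eq (edge≢edge (adj v∈) (adj w∈) v≢w)

  colours-unique : Unique (vertex u ∷ map (edge u) (neighbours u))
  colours-unique =
    All.map⁺ (All.tabulate (λ v∈ → vertex≢edge (adj v∈)))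
    ∷ map-unique edge-injective (filter⁺ (adj? u) (allFin⁺ n))

-- Congruences

⟦_⟧ : ∀ {m} → Fin m → ℤ
⟦ i ⟧ = + toℕ i

infix 4 _≡_[mod_]

-- A record, so that unification recovers `a`, `b` and `m` from the type; bare divisibility would
-- expose only their difference.
record _≡_[mod_] (a b : ℤ) (m : ℕ) : Set where
  constructor modulo
  field divides : + m ℤ.∣ a ℤ.- b

open _≡_[mod_]

module _ {m : ℕ} where

  -- Congruence depends only on the difference of the two sides, which leaves a ring identity to
  -- check.
  rearrange : ∀ {a b c d} → a ℤ.- b ≡ c ℤ.- d → a ≡ b [mod m ] → c ≡ d [mod m ]
  rearrange eq (modulo p) = modulo (subst (+ m ℤ.∣_) eq p)

  mod-refl : ∀ {a} → a ≡ a [mod m ]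
  mod-refl {a} = modulo (ℤ.divides (+ 0) (ℤ.+-inverseʳ a))

  mod-reflexive : ∀ {a b} → a ≡ b → a ≡ b [mod m ]
  mod-reflexive refl = mod-refl

  mod-sym : ∀ {a b} → a ≡ b [mod m ] → b ≡ a [mod m ]
  mod-sym {a} {b} (modulo p) = modulo (subst (+ m ℤ.∣_) (eq a b) (ℤ.∣m⇒∣-m p))
    where
    eq : ∀ a b → ℤ.- (a ℤ.- b) ≡ b ℤ.- a
    eq = solve-∀

  mod-trans : ∀ {a b c} → a ≡ b [mod m ] → b ≡ c [mod m ] → a ≡ c [mod m ]
  mod-trans {a} {b} {c} (modulo p) (modulo q) =
    modulo (subst (+ m ℤ.∣_) (eq a b c) (ℤ.∣m∣n⇒∣m+n p q))
    where
    eq : ∀ a b c → (a ℤ.- b) ℤ.+ (b ℤ.- c) ≡ a ℤ.- c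
    eq = solve-∀

  mod-+ : ∀ {a b c d} → a ≡ b [mod m ] → c ≡ d [mod m ] → a ℤ.+ c ≡ b ℤ.+ d [mod m ]
  mod-+ {a} {b} {c} {d} (modulo p) (modulo q) =
    modulo (subst (+ m ℤ.∣_) (eq a b c d) (ℤ.∣m∣n⇒∣m+n p q))
    where
    eq : ∀ a b c d → (a ℤ.- b) ℤ.+ (c ℤ.- d) ≡ (a ℤ.+ c) ℤ.- (b ℤ.+ d)
    eq = solve-∀

  mod-+ˡ : ∀ a {b c} → b ≡ c [mod m ] → a ℤ.+ b ≡ a ℤ.+ c [mod m ]
  mod-+ˡ a = mod-+ (mod-refl {a})

  mod-+ʳ : ∀ {a b} c → a ≡ b [mod m ] → a ℤ.+ c ≡ b ℤ.+ c [mod m ]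
  mod-+ʳ c p = mod-+ p (mod-refl {c})

  mod-cancelˡ : ∀ a {b c} → a ℤ.+ b ≡ a ℤ.+ c [mod m ] → b ≡ c [mod m ]
  mod-cancelˡ a {b} {c} = rearrange (eq a b c)
    where
    eq : ∀ a b c → (a ℤ.+ b) ℤ.- (a ℤ.+ c) ≡ b ℤ.- c
    eq = solve-∀

  mod-cancelʳ : ∀ {a b} c → a ℤ.+ c ≡ b ℤ.+ c [mod m ] → a ≡ b [mod m ]
  mod-cancelʳ {a} {b} c = rearrange (eq a b c)
    where
    eq : ∀ a b c → (a ℤ.+ c) ℤ.- (b ℤ.+ c) ≡ a ℤ.- b
    eq = solve-∀

  mod-∣ : ∀ {a b d} → d ∣ m → a ≡ b [mod m ] → a ≡ b [mod d ]
  mod-∣ d∣m (modulo p) = modulo (ℤ.∣-trans (ℤ.∣ᵤ⇒∣ d∣m) p)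

  -- A nonzero multiple of `m` has absolute value at least `m`.
  mod-small : ∀ {a b} → ∣ a ℤ.- b ∣ < m → a ≡ b [mod m ] → a ≡ b
  mod-small {a} {b} small (modulo p) with ∣ a ℤ.- b ∣ in eq | ℤ.∣⇒∣ᵤ p
  ... | zero  | _   = ℤ.i-j≡0⇒i≡j a b (ℤ.∣i∣≡0⇒i≡0 eq)
  ... | suc _ | m∣d = contradiction (∣⇒≤ m∣d) (ℕ.<⇒≱ small)

  ⟦⟧-injective : ∀ {i j : Fin m} → ⟦ i ⟧ ≡ ⟦ j ⟧ [mod m ] → i ≡ j
  ⟦⟧-injective {i} {j} p = toℕ-injective (ℤ.+-injective (mod-small small p))
    where
    small : ∣ ⟦ i ⟧ ℤ.- ⟦ j ⟧ ∣ < m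
    small = ℕ.≤-<-trans
      (ℕ.≤-trans (ℕ.≤-reflexive (cong ∣_∣ (ℤ.m-n≡m⊖n (toℕ i) (toℕ j)))) (ℤ.∣m⊝n∣≤m⊔n (toℕ i) (toℕ j)))
      (ℕ.⊔-lub (toℕ<n i) (toℕ<n j))

  -- Multiply by `h + 1`, an inverse of 2 because `2(h + 1) = m + 1`.
  halve : ∀ h {a b} → + m ≡ + 2 ℤ.* h ℤ.+ + 1 → a ℤ.+ a ≡ b ℤ.+ b [mod m ] → a ≡ b [mod m ]
  halve h {a} {b} odd (modulo p) = modulo
    (ℤ.∣m+n∣n⇒∣m {m = a ℤ.- b} {n = (a ℤ.- b) ℤ.* + m} sum∣ (ℤ.∣n⇒∣m*n (a ℤ.- b) ℤ.∣-refl))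
    where
    eq : ∀ a b h → (h ℤ.+ + 1) ℤ.* (a ℤ.+ a ℤ.- (b ℤ.+ b)) ≡
                   a ℤ.- b ℤ.+ (a ℤ.- b) ℤ.* (+ 2 ℤ.* h ℤ.+ + 1)
    eq = solve-∀

    sum∣ : + m ℤ.∣ a ℤ.- b ℤ.+ (a ℤ.- b) ℤ.* + m
    sum∣ = subst (λ r → + m ℤ.∣ a ℤ.- b ℤ.+ (a ℤ.- b) ℤ.* r) (sym odd)
      (subst (+ m ℤ.∣_) (eq a b h) (ℤ.∣n⇒∣m*n (h ℤ.+ + 1) p))

  -- With `h + 1` as inverse of 2, the difference of the two sides is `(d - c) * m`.
  double-half : ∀ h c d → + m ≡ + 2 ℤ.* h ℤ.+ + 1 →
                let s = (h ℤ.+ + 1) ℤ.* (d ℤ.- c) in c ℤ.+ (s ℤ.+ s) ≡ d [mod m ]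
  double-half h c d odd =
    modulo (ℤ.divides (d ℤ.- c) (trans (eq c d h) (cong ((d ℤ.- c) ℤ.*_) (sym odd))))
    where
    eq : ∀ c d h → c ℤ.+ ((h ℤ.+ + 1) ℤ.* (d ℤ.- c) ℤ.+ (h ℤ.+ + 1) ℤ.* (d ℤ.- c)) ℤ.- d ≡
                   (d ℤ.- c) ℤ.* (+ 2 ℤ.* h ℤ.+ + 1)
    eq = solve-∀

module _ (m : ℕ) .{{_ : NonZero m}} where

  -- Later arguments use only `residue-≡`; the division behind it stays folded.
  abstract
    residue : ℤ → Fin m
    residue z = fromℕ< (ℤ.n%ℕd<d z m)

    residue-≡ : ∀ z → ⟦ residue z ⟧ ≡ z [mod m ]
    residue-≡ z = mod-sym (modulo (ℤ.divides (z ℤ./ℕ m) (trans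
      (cong₂ ℤ._-_ (ℤ.a≡a%ℕn+[a/ℕn]*n z m) (cong +_ (toℕ-fromℕ< (ℤ.n%ℕd<d z m))))
      (eq (+ (z ℤ.%ℕ m)) _))))
      where
      eq : ∀ a b → (a ℤ.+ b) ℤ.- a ≡ b
      eq = solve-∀

  residue-injective : ∀ {a b} → residue a ≡ residue b → a ≡ b [mod m ]
  residue-injective {a} {b} eq =
    mod-trans (mod-sym (residue-≡ a)) (subst (λ r → ⟦ r ⟧ ≡ b [mod m ]) (sym eq) (residue-≡ b))

-- Powers of cycles

module _ (n k : ℕ) where

  -- One signed offset replaces the two directions of a step, and offset 0 is allowed, so this
  -- describes closed neighbourhoods.
  Near : Fin n → Fin n → Set
  Near u v = ∃[ a ] (∣ a ∣ ≤ k × ⟦ v ⟧ ≡ ⟦ u ⟧ ℤ.+ a [mod n ])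

  near-refl : ∀ u → Near u u
  near-refl u = + 0 , z≤n , mod-reflexive (sym (ℤ.+-identityʳ ⟦ u ⟧))

  cyclePowerAdj⇒near : ∀ {u v} → CyclePowerAdj n k u v → Near u v
  cyclePowerAdj⇒near {u} {v} (_ , i , inj₁ p) =
    -[1+ toℕ i ] , toℕ<n i ,
    mod-sym (modulo (subst (+ n ℤ.∣_) (eq ⟦ u ⟧ ⟦ v ⟧ (+ suc (toℕ i))) (ℤ.∣ᵤ⇒∣ p)))
    where
    eq : ∀ a b c → a ℤ.- b ℤ.- c ≡ (a ℤ.+ (ℤ.- c)) ℤ.- b
    eq = solve-∀
  cyclePowerAdj⇒near {u} {v} (_ , i , inj₂ p) =
    + suc (toℕ i) , toℕ<n i ,
    mod-sym (modulo (subst (+ n ℤ.∣_) (eq ⟦ u ⟧ ⟦ v ⟧ (+ suc (toℕ i))) (ℤ.∣ᵤ⇒∣ p)))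
    where
    eq : ∀ a b c → a ℤ.- b ℤ.+ c ≡ (a ℤ.+ c) ℤ.- b
    eq = solve-∀

  near⇒cyclePowerAdj : ∀ {u v} → u ≢ v → Near u v → CyclePowerAdj n k u v
  near⇒cyclePowerAdj {u} u≢v (+ zero , _ , p) =
    contradiction (⟦⟧-injective (mod-sym (mod-trans p (mod-reflexive (ℤ.+-identityʳ ⟦ u ⟧))))) u≢v
  near⇒cyclePowerAdj {u} {v} u≢v (+ suc j , j<k , p) = u≢v , fromℕ< j<k , inj₂ (ℤ.∣⇒∣ᵤ
    (subst (λ i → + n ℤ.∣ ⟦ u ⟧ ℤ.- ⟦ v ⟧ ℤ.+ + suc i) (sym (toℕ-fromℕ< j<k))
      (subst (+ n ℤ.∣_) (eq ⟦ u ⟧ ⟦ v ⟧ (+ suc j)) (divides (mod-sym p)))))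
    where
    eq : ∀ a b c → (a ℤ.+ c) ℤ.- b ≡ a ℤ.- b ℤ.+ c
    eq = solve-∀
  near⇒cyclePowerAdj {u} {v} u≢v (-[1+ j ] , j<k , p) = u≢v , fromℕ< j<k , inj₁ (ℤ.∣⇒∣ᵤ
    (subst (λ i → + n ℤ.∣ ⟦ u ⟧ ℤ.- ⟦ v ⟧ ℤ.- + suc i) (sym (toℕ-fromℕ< j<k))
      (subst (+ n ℤ.∣_) (eq ⟦ u ⟧ ⟦ v ⟧ (+ suc j)) (divides (mod-sym p)))))
    where
    eq : ∀ a b c → (a ℤ.+ (ℤ.- c)) ℤ.- b ≡ a ℤ.- b ℤ.- c
    eq = solve-∀

-- Closed neighbourhoods as complete systems of residues, and the base colouring

module Colouring {n k : ℕ} .{{_ : NonZero n}} (bound : suc k + suc k ≤ n) (q∣n : 2 * k + 1 ∣ n)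
  -- `G` is kept abstract: its adjacency enters only as nearness of distinct vertices.
  (G : Graph n)
  (adj⇒near : ∀ {u v} → Graph.Adj G u v → Near n k u v)
  (near⇒adj : ∀ {u v} → u ≢ v → Near n k u v → Graph.Adj G u v)
  where

  open Graph G

  q : ℕ
  q = 2 * k + 1

  instance
    q-nonZero : NonZero q
    q-nonZero = >-nonZero (ℕ.m≤n+m 1 (2 * k))

  k+k<q : k + k < q
  k+k<q = ℕ.≤-reflexive (trans (sym (ℕ.+-comm (k + k) 1)) (cong (λ j → k + j + 1) (sym (ℕ.+-identityʳ k))))

  adj⇒≢ : ∀ {u v} → Adj u v → u ≢ v
  adj⇒≢ p u≡v = irrefl u≡v p

  -- The offsets of `v` and `w` from `u` are congruent modulo `q`, because `q` divides `n`, and they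
  -- differ by at most `2k < q`, so they are equal.
  near-injective : ∀ {u v w} → Near n k u v → Near n k u w → ⟦ v ⟧ ≡ ⟦ w ⟧ [mod q ] → v ≡ w
  near-injective {u} {v} {w} (a , a≤k , v≡u+a) (b , b≤k , w≡u+b) v≡w =
    ⟦⟧-injective (mod-trans v≡u+a (subst (λ c → ⟦ u ⟧ ℤ.+ c ≡ ⟦ w ⟧ [mod n ]) (sym a≡b) (mod-sym w≡u+b)))
    where
    a≡b : a ≡ b
    a≡b = mod-small
      (ℕ.≤-<-trans (ℤ.∣i-j∣≤∣i∣+∣j∣ a b) (ℕ.≤-<-trans (ℕ.+-mono-≤ a≤k b≤k) k+k<q))
      (mod-cancelˡ ⟦ u ⟧ (mod-trans (mod-sym (mod-∣ q∣n v≡u+a)) (mod-trans v≡w (mod-∣ q∣n w≡u+b))))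

  -- The offsets from `-k` to `k` are `q` consecutive integers, so one of them lies in the class of
  -- `z - u`.
  near-surjective : ∀ u z → ∃[ v ] (Near n k u v × ⟦ v ⟧ ≡ z [mod q ])
  near-surjective u z = v , (a , ∣a∣≤k , v≡u+a) , mod-trans (mod-∣ q∣n v≡u+a) u+a≡z
    where
    t : Fin q
    -- Adding `k` before the reduction and removing it afterwards puts the representative between
    -- `-k` and `k`.
    t = residue q (z ℤ.- ⟦ u ⟧ ℤ.+ + k)

    a : ℤ
    a = ⟦ t ⟧ ℤ.- + k

    v : Fin n
    v = residue n (⟦ u ⟧ ℤ.+ a)

    v≡u+a : ⟦ v ⟧ ≡ ⟦ u ⟧ ℤ.+ a [mod n ]
    v≡u+a = residue-≡ n (⟦ u ⟧ ℤ.+ a)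

    ∣a∣≤k : ∣ a ∣ ≤ k
    ∣a∣≤k rewrite ℤ.m-n≡m⊖n (toℕ t) k with ℕ.≤-total (toℕ t) k
    ... | inj₁ t≤k rewrite ℤ.∣⊖∣-≤ t≤k = ℕ.m∸n≤m k (toℕ t)
    ... | inj₂ k≤t rewrite ℤ.⊖-≥ k≤t = ℕ.m≤n+o⇒m∸n≤o (toℕ t) k
      (ℕ.<⇒≤pred (subst (toℕ t <_)
        (trans (ℕ.+-comm (2 * k) 1) (cong (λ j → suc (k + j)) (ℕ.+-identityʳ k))) (toℕ<n t)))

    u+a≡z : ⟦ u ⟧ ℤ.+ a ≡ z [mod q ]
    u+a≡z = rearrange (eq ⟦ t ⟧ ⟦ u ⟧ z (+ k)) (residue-≡ q (z ℤ.- ⟦ u ⟧ ℤ.+ + k))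
      where
      eq : ∀ t u z k → t ℤ.- (z ℤ.- u ℤ.+ k) ≡ (u ℤ.+ (t ℤ.- k)) ℤ.- z
      eq = solve-∀

  ball : Fin n → List (Fin n)
  ball u = u ∷ neighbours u

  ∈neighbours⇒adj : ∀ {u v} → v ∈ neighbours u → Adj u v
  ∈neighbours⇒adj {u} v∈ = proj₂ (∈-filter⁻ (adj? u) {xs = allFin n} v∈)

  adj⇒∈neighbours : ∀ {u v} → Adj u v → v ∈ neighbours u
  adj⇒∈neighbours {u} {v} = ∈-filter⁺ (adj? u) (∈-allFin v)

  ∈ball⇒near : ∀ {u v} → v ∈ ball u → Near n k u v
  ∈ball⇒near (here refl) = near-refl n k _
  ∈ball⇒near (there v∈)  = adj⇒near (∈neighbours⇒adj v∈)

  near⇒∈ball : ∀ {u v} → Near n k u v → v ∈ ball u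
  near⇒∈ball {u} {v} near with u ≟ v
  ... | yes refl = here refl
  ... | no  u≢v  = there (adj⇒∈neighbours (near⇒adj u≢v near))

  neighbours-unique : ∀ u → Unique (neighbours u)
  neighbours-unique u = filter⁺ (adj? u) (allFin⁺ n)

  ball-unique : ∀ u → Unique (ball u)
  ball-unique u = All.tabulate (λ v∈ → adj⇒≢ (∈neighbours⇒adj v∈)) ∷ neighbours-unique u

  -- The diagonal `colour u u` serves as the colour of the vertex `u`, so the colours seen at `u`
  -- are the image of `ball u`.
  colour : Fin n → Fin n → Fin q
  colour u v = residue q (⟦ u ⟧ ℤ.+ ⟦ v ⟧)

  colour-comm : ∀ u v → colour u v ≡ colour v u
  colour-comm u v = cong (residue q) (ℤ.+-comm ⟦ u ⟧ ⟦ v ⟧)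

  colour-injective : ∀ {u v w} → Near n k u v → Near n k u w → colour u v ≡ colour u w → v ≡ w
  colour-injective {u} nv nw eq = near-injective nv nw (mod-cancelˡ ⟦ u ⟧ (residue-injective q eq))

  -- Translation by `u` keeps a system of residues complete. Both the degree and the common colour
  -- sum are read off from this.
  colours↭allFin : ∀ u → map (colour u) (ball u) ↭ allFin q
  colours↭allFin u = unique⇒↭
    (map-unique (λ v∈ w∈ → colour-injective (∈ball⇒near v∈) (∈ball⇒near w∈)) (ball-unique u))
    (allFin⁺ q) (λ {i} _ → ∈-allFin i) (λ {i} _ → attained i)
    where
    attained : ∀ i → i ∈ map (colour u) (ball u)
    attained i =
      let v , near , v≡ = near-surjective u (⟦ i ⟧ ℤ.- ⟦ u ⟧) in
      subst (_∈ map (colour u) (ball u)) (colour≡ v v≡) (∈-map⁺ (colour u) (near⇒∈ball near))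
      where
      eq : ∀ u v i → v ℤ.- (i ℤ.- u) ≡ (u ℤ.+ v) ℤ.- i
      eq = solve-∀

      colour≡ : ∀ v → ⟦ v ⟧ ≡ ⟦ i ⟧ ℤ.- ⟦ u ⟧ [mod q ] → colour u v ≡ i
      colour≡ v v≡ = ⟦⟧-injective (mod-trans (residue-≡ q (⟦ u ⟧ ℤ.+ ⟦ v ⟧))
        (rearrange (eq ⟦ u ⟧ ⟦ v ⟧ ⟦ i ⟧) v≡))

  -- The closed neighbourhood has as many members as there are colours.
  degree≡2k : ∀ u → degree u ≡ 2 * k
  degree≡2k u = ℕ.suc-injective (begin
    length (ball u)                  ≡⟨ length-map (colour u) (ball u) ⟨
    length (map (colour u) (ball u)) ≡⟨ ↭-length (colours↭allFin u) ⟩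
    length (allFin q)                ≡⟨ length-tabulate {n = q} (λ i → i) ⟩
    2 * k + 1                        ≡⟨ ℕ.+-comm (2 * k) 1 ⟩
    suc (2 * k)                      ∎)
    where open ≡-Reasoning

  origin : Fin n
  origin = residue n (+ 0)

  Δ≡2k : Δ G ≡ 2 * k
  Δ≡2k = ℕ.≤-antisym
    (max≤v⁺ {xs = map degree (allFin n)} z≤n (All.map⁺ (All.tabulate (λ {u} _ → ℕ.≤-reflexive (degree≡2k u)))))
    (v≤max⁺ 0 (map degree (allFin n)) (inj₂ (Any.map⁺ (Any.map
      (λ { refl → ℕ.≤-reflexive (sym (degree≡2k origin)) }) (∈-allFin origin)))))

  q≤colours : ∀ {m} → TotalColouring G m → q ≤ m
  q≤colours {m} c = subst (_≤ m) (trans (cong suc (degree≡2k origin)) (ℕ.+-comm 1 (2 * k)))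
                          (totalColouring⇒degree< c origin)

  +q≡ : + q ≡ + 2 ℤ.* + k ℤ.+ + 1
  +q≡ = cong (ℤ._+ + 1) (ℤ.pos-* 2 k)

  base : TotalColouring G q
  base = record
    { vertex        = λ u → colour u u
    ; edge          = colour
    ; edge-sym      = λ {u} {v} _ → colour-comm u v
    -- Equal vertex colours mean `2u ≡ 2v`, and `q` is odd.
    ; vertex≢vertex = λ {u} p eq → adj⇒≢ p (near-injective (near-refl n k u) (adj⇒near p)
        (halve (+ k) +q≡ (residue-injective q eq)))
    ; edge≢edge     = λ p p′ v≢w eq → v≢w (colour-injective (adj⇒near p) (adj⇒near p′) eq)
    ; vertex≢edge   = λ {u} p eq → adj⇒≢ p (colour-injective (near-refl n k u) (adj⇒near p) eq)
    }

  -- Rotations and the equitability of the base colouring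

  module _ (s : ℤ) where

    rotate : Fin n → Fin n
    rotate u = residue n (⟦ u ⟧ ℤ.+ s)

    rotate-injective : ∀ {u v} → rotate u ≡ rotate v → u ≡ v
    rotate-injective eq = ⟦⟧-injective (mod-cancelʳ s (residue-injective n eq))

    rotate-near : ∀ {u v} → Near n k u v → Near n k (rotate u) (rotate v)
    rotate-near {u} {v} (a , a≤k , p) = a , a≤k ,
      mod-trans (residue-≡ n _) (mod-trans (rearrange (eq ⟦ u ⟧ ⟦ v ⟧ a s) p)
        (mod-+ʳ a (mod-sym (residue-≡ n _))))
      where
      eq : ∀ u v a s → v ℤ.- (u ℤ.+ a) ≡ (v ℤ.+ s) ℤ.- (u ℤ.+ s ℤ.+ a)
      eq = solve-∀

    rotate-adj : ∀ {u v} → Adj u v → Adj (rotate u) (rotate v)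
    rotate-adj p = near⇒adj (λ eq → adj⇒≢ p (rotate-injective eq)) (rotate-near (adj⇒near p))

    -- Each endpoint moves by `s`, so the sum moves by `2s`; wrapping round modulo `n` does no harm
    -- since `q` divides `n`.
    colour-rotate : ∀ {u v d} → ⟦ colour u v ⟧ ℤ.+ (s ℤ.+ s) ≡ ⟦ d ⟧ [mod q ] →
                    colour (rotate u) (rotate v) ≡ d
    colour-rotate {u} {v} {d} p = ⟦⟧-injective (mod-trans (residue-≡ q _) (mod-trans
      (mod-+ (mod-∣ q∣n (residue-≡ n _)) (mod-∣ q∣n (residue-≡ n _)))
      (mod-trans (rearrange (eq ⟦ u ⟧ ⟦ v ⟧ s ⟦ colour u v ⟧) (mod-sym (residue-≡ q (⟦ u ⟧ ℤ.+ ⟦ v ⟧)))) p)))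
      where
      eq : ∀ u v s c → (u ℤ.+ v) ℤ.- c ≡ (u ℤ.+ s ℤ.+ (v ℤ.+ s)) ℤ.- (c ℤ.+ (s ℤ.+ s))
      eq = solve-∀

    -- Edges are listed with the smaller endpoint first, and wrapping round can reverse the order.
    rotateEdge : Fin n × Fin n → Fin n × Fin n
    rotateEdge (u , v) with rotate u Fin.<? rotate v
    ... | yes _ = rotate u , rotate v
    ... | no  _ = rotate v , rotate u

    rotateEdge-injective : ∀ {u v u′ v′} → u Fin.< v → u′ Fin.< v′ →
                           rotateEdge (u , v) ≡ rotateEdge (u′ , v′) → (u , v) ≡ (u′ , v′)
    rotateEdge-injective {u} {v} {u′} {v′} u<v u′<v′ eq
      with rotate u Fin.<? rotate v | rotate u′ Fin.<? rotate v′
    ... | yes _ | yes _ = cong₂ _,_ (rotate-injective (cong proj₁ eq)) (rotate-injective (cong proj₂ eq))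
    ... | no  _ | no  _ = cong₂ _,_ (rotate-injective (cong proj₂ eq)) (rotate-injective (cong proj₁ eq))
    -- If only one image is swapped, then `u = v′` and `v = u′`, although both pairs are increasing.
    ... | yes _ | no  _ = contradiction
      (subst₂ Fin._<_ (sym (rotate-injective (cong proj₂ eq))) (sym (rotate-injective (cong proj₁ eq))) u′<v′)
      (ℕ.<-asym u<v)
    ... | no  _ | yes _ = contradiction
      (subst₂ Fin._<_ (sym (rotate-injective (cong proj₁ eq))) (sym (rotate-injective (cong proj₂ eq))) u′<v′)
      (ℕ.<-asym u<v)

  edge? : ((u , v) : Fin n × Fin n) → Dec (u Fin.< v × Adj u v)
  edge? (u , v) = (u Fin.<? v) ×-dec adj? u v

  edge⇒∈edges : ∀ {u v} → u Fin.< v → Adj u v → (u , v) ∈ edges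
  edge⇒∈edges {u} {v} u<v p = ∈-filter⁺ edge? (∈-cartesianProduct⁺ (∈-allFin u) (∈-allFin v)) (u<v , p)

  ∈edges⇒edge : ∀ {u v} → (u , v) ∈ edges → u Fin.< v × Adj u v
  ∈edges⇒edge e∈ = proj₂ (∈-filter⁻ edge? {xs = cartesianProduct (allFin n) (allFin n)} e∈)

  edges-unique : Unique edges
  edges-unique = filter⁺ edge? (cartesianProduct⁺ (allFin⁺ n) (allFin⁺ n))

  rotateEdge-∈ : ∀ s {u v} → (u , v) ∈ edges → rotateEdge s (u , v) ∈ edges
  rotateEdge-∈ s {u} {v} e∈ with rotate s u Fin.<? rotate s v
  ... | yes u<v = edge⇒∈edges u<v (rotate-adj s (proj₂ (∈edges⇒edge e∈)))
  ... | no  u≮v with <-cmp (rotate s u) (rotate s v)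
  ...   | tri< u<v _ _ = contradiction u<v u≮v
  ...   | tri≈ _ u≡v _ = contradiction (rotate-injective s u≡v) (adj⇒≢ (proj₂ (∈edges⇒edge e∈)))
  ...   | tri> _ _ v<u = edge⇒∈edges v<u (symm (rotate-adj s (proj₂ (∈edges⇒edge e∈))))

  rotateEdge-colour : ∀ s {u v d} → ⟦ colour u v ⟧ ℤ.+ (s ℤ.+ s) ≡ ⟦ d ⟧ [mod q ] →
                      colour (proj₁ (rotateEdge s (u , v))) (proj₂ (rotateEdge s (u , v))) ≡ d
  rotateEdge-colour s {u} {v} p with rotate s u Fin.<? rotate s v
  ... | yes _ = colour-rotate s p
  ... | no  _ = trans (colour-comm (rotate s v) (rotate s u)) (colour-rotate s p)

  open TotalColouring using (classSize; Equitable; NeighbourSumDistinguishing)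

  -- A rotation injects the class of `c` into that of `d`, on vertices and edges separately.
  -- Exchanging `c` and `d` gives equality.
  base-classSize-≤ : ∀ c d → classSize base c ≤ classSize base d
  base-classSize-≤ c d = ℕ.+-mono-≤ vertices-≤ edges-≤
    where
    -- 2(k + 1) ≡ 1 modulo q, so s is half of d - c.
    s : ℤ
    s = (+ k ℤ.+ + 1) ℤ.* (⟦ d ⟧ ℤ.- ⟦ c ⟧)

    c+2s≡d : ⟦ c ⟧ ℤ.+ (s ℤ.+ s) ≡ ⟦ d ⟧ [mod q ]
    c+2s≡d = double-half (+ k) ⟦ c ⟧ ⟦ d ⟧ +q≡

    vertexClass? : ∀ c u → Dec (colour u u ≡ c)
    vertexClass? c u = colour u u ≟ c

    edgeClass? : ∀ c ((u , v) : Fin n × Fin n) → Dec (colour u v ≡ c)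
    edgeClass? c (u , v) = colour u v ≟ c

    vertices-≤ : length (filter (vertexClass? c) (allFin n)) ≤ length (filter (vertexClass? d) (allFin n))
    vertices-≤ = injection⇒length≤ {f = rotate s} (filter⁺ (vertexClass? c) (allFin⁺ n))
      (λ {u} u∈ → ∈-filter⁺ (vertexClass? d) (∈-allFin (rotate s u))
        (colour-rotate s (shifted (proj₂ (∈-filter⁻ (vertexClass? c) {xs = allFin n} u∈)))))
      (λ _ _ → rotate-injective s)
      where
      shifted : ∀ {i} → i ≡ c → ⟦ i ⟧ ℤ.+ (s ℤ.+ s) ≡ ⟦ d ⟧ [mod q ]
      shifted refl = c+2s≡d

    edges-≤ : length (filter (edgeClass? c) edges) ≤ length (filter (edgeClass? d) edges)
    edges-≤ = injection⇒length≤ {f = rotateEdge s} (filter⁺ (edgeClass? c) edges-unique)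
      (λ e∈ → let e∈edges , eq = ∈-filter⁻ (edgeClass? c) {xs = edges} e∈ in
        ∈-filter⁺ (edgeClass? d) (rotateEdge-∈ s e∈edges) (rotateEdge-colour s (shifted eq)))
      (λ e∈ e′∈ → rotateEdge-injective s (ordered e∈) (ordered e′∈))
      where
      shifted : ∀ {i} → i ≡ c → ⟦ i ⟧ ℤ.+ (s ℤ.+ s) ≡ ⟦ d ⟧ [mod q ]
      shifted refl = c+2s≡d

      ordered : ∀ {u v} → (u , v) ∈ filter (edgeClass? c) edges → u Fin.< v
      ordered e∈ = proj₁ (∈edges⇒edge (proj₁ (∈-filter⁻ (edgeClass? c) {xs = edges} e∈)))

  base-equitable : Equitable base
  base-equitable c d = ℕ.m≤n⇒m≤1+n (base-classSize-≤ c d)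

  -- Recolouring a Hamiltonian cycle with two new colours

  module Distinguishing (1≤k : 1 ≤ k) (2∣n : 2 ∣ n) where

    next prev : Fin n → Fin n
    next = rotate (+ 1)
    prev = rotate (ℤ.- (+ 1))

    2<n : 2 < n
    2<n = ℕ.≤-trans (ℕ.n≤1+n 3) (ℕ.≤-trans (ℕ.+-mono-≤ (s≤s 1≤k) (s≤s 1≤k)) bound)

    rotate-rotate : ∀ s t u → s ℤ.+ t ≡ + 0 → rotate t (rotate s u) ≡ u
    rotate-rotate s t u s+t≡0 = ⟦⟧-injective (mod-trans (residue-≡ n _)
      (mod-trans (mod-+ʳ t (residue-≡ n (⟦ u ⟧ ℤ.+ s))) (mod-reflexive
        (trans (ℤ.+-assoc ⟦ u ⟧ s t) (trans (cong (λ r → ⟦ u ⟧ ℤ.+ r) s+t≡0) (ℤ.+-identityʳ ⟦ u ⟧))))))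

    next-prev : ∀ u → next (prev u) ≡ u
    next-prev u = rotate-rotate (ℤ.- (+ 1)) (+ 1) u refl

    prev-next : ∀ u → prev (next u) ≡ u
    prev-next u = rotate-rotate (+ 1) (ℤ.- (+ 1)) u refl

    -- The offsets 1 and -1 differ by 2, which is less than `n`.
    next≢prev : ∀ u → next u ≢ prev u
    next≢prev u eq = contradiction {A = + 1 ≡ ℤ.- (+ 1)}
      (mod-small 2<n (mod-cancelˡ ⟦ u ⟧ (residue-injective n eq))) (λ ())

    parity : Fin n → Fin 2
    parity u = residue 2 ⟦ u ⟧

    -- As `n` is even, reduction modulo `n` preserves parity, so parities alternate also where the
    -- cycle closes up.
    parity-next : ∀ u → parity (next u) ≢ parity u
    parity-next u eq = contradiction {A = + 1 ≡ + 0} (mod-small ℕ.≤-refl 1≡0) (λ ())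
      where
      1≡0 : + 1 ≡ + 0 [mod 2 ]
      1≡0 = mod-cancelˡ ⟦ u ⟧ (mod-trans
        (mod-sym (mod-∣ 2∣n (residue-≡ n (⟦ u ⟧ ℤ.+ + 1))))
        (mod-trans (residue-injective 2 eq) (mod-reflexive (sym (ℤ.+-identityʳ ⟦ u ⟧)))))

    adj-next : ∀ u → Adj u (next u)
    adj-next u = near⇒adj (λ eq → parity-next u (cong parity (sym eq)))
                          (+ 1 , 1≤k , residue-≡ n (⟦ u ⟧ ℤ.+ + 1))

    adj-prev : ∀ u → Adj u (prev u)
    adj-prev u = symm (subst (Adj (prev u)) (next-prev u) (adj-next (prev u)))

    -- A cycle edge thus has a single direction, which makes forward and backward exclusive.
    no-2-cycle : ∀ {u v} → v ≡ next u → u ≢ next v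
    no-2-cycle {u} {v} v≡ u≡ = next≢prev u (trans (sym v≡) (trans (sym (prev-next v)) (cong prev (sym u≡))))

    -- The recolouring as a relation, so that properness becomes case analysis. A cycle edge takes
    -- the parity of its tail, the endpoint whose successor is the other one, shifted past the `q`
    -- old colours.
    data EdgeColour (u v : Fin n) : Fin (q + 2) → Set where
      forward  : v ≡ next u → EdgeColour u v (q ↑ʳ parity u)
      backward : u ≡ next v → EdgeColour u v (q ↑ʳ parity v)
      chord    : v ≢ next u → u ≢ next v → EdgeColour u v (colour u v ↑ˡ 2)

    edgeColour : ∀ u v → ∃ (EdgeColour u v)
    edgeColour u v with v ≟ next u | u ≟ next v
    ... | yes p | _     = _ , forward p
    ... | no  _ | yes p = _ , backward p
    ... | no ¬p | no ¬r = _ , chord ¬p ¬r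

    newEdge : Fin n → Fin n → Fin (q + 2)
    newEdge u v = proj₁ (edgeColour u v)

    -- This also computes `newEdge`: any constructor exhibited for the reversed pair determines the
    -- colour.
    edgeColour-sym : ∀ {u v c d} → EdgeColour u v c → EdgeColour v u d → c ≡ d
    edgeColour-sym (forward p)  (forward r)  = contradiction r (no-2-cycle p)
    edgeColour-sym (forward p)  (backward r) = refl
    edgeColour-sym (forward p)  (chord _ ¬r) = contradiction p ¬r
    edgeColour-sym (backward p) (forward r)  = refl
    edgeColour-sym (backward p) (backward r) = contradiction p (no-2-cycle r)
    edgeColour-sym (backward p) (chord ¬r _) = contradiction p ¬r
    edgeColour-sym (chord _ ¬p) (forward r)  = contradiction r ¬p
    edgeColour-sym (chord ¬p _) (backward r) = contradiction r ¬p
    edgeColour-sym {u} {v} (chord _ _) (chord _ _) = cong (_↑ˡ 2) (colour-comm u v)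

    ↑ˡ≢↑ʳ : ∀ {i : Fin q} {j : Fin 2} → i ↑ˡ 2 ≢ q ↑ʳ j
    ↑ˡ≢↑ʳ {i} {j} eq = ℕ.<⇒≱ (toℕ<n i) (subst (q ≤_)
      (trans (sym (toℕ-↑ʳ q j)) (trans (cong toℕ (sym eq)) (toℕ-↑ˡ i 2))) (ℕ.m≤m+n q (toℕ j)))

    parity-distinct : ∀ {u v} → u ≡ next v → parity u ≢ parity v
    parity-distinct {v = v} u≡ eq = parity-next v (trans (cong parity (sym u≡)) eq)

    -- Two forward edges at `u` share their head and two backward ones their tail, while a forward
    -- and a backward edge carry the parities of consecutive vertices.
    edgeColour-distinct : ∀ {u v w c d} → Adj u v → Adj u w → v ≢ w →
                          EdgeColour u v c → EdgeColour u w d → c ≢ d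
    edgeColour-distinct _ _ v≢w (forward p)  (forward r)  _  = v≢w (trans p (sym r))
    edgeColour-distinct _ _ v≢w (forward p)  (backward r) eq = parity-distinct r (↑ʳ-injective q _ _ eq)
    edgeColour-distinct _ _ v≢w (backward p) (forward r)  eq = parity-distinct p (sym (↑ʳ-injective q _ _ eq))
    edgeColour-distinct _ _ v≢w (backward p) (backward r) _  = v≢w (rotate-injective (+ 1) (trans (sym p) r))
    edgeColour-distinct _ _ v≢w (forward _)  (chord _ _)  eq = ↑ˡ≢↑ʳ (sym eq)
    edgeColour-distinct _ _ v≢w (backward _) (chord _ _)  eq = ↑ˡ≢↑ʳ (sym eq)
    edgeColour-distinct _ _ v≢w (chord _ _)  (forward _)  eq = ↑ˡ≢↑ʳ eq
    edgeColour-distinct _ _ v≢w (chord _ _)  (backward _) eq = ↑ˡ≢↑ʳ eq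
    edgeColour-distinct p p′ v≢w (chord _ _) (chord _ _)  eq =
      v≢w (colour-injective (adj⇒near p) (adj⇒near p′) (↑ˡ-injective 2 _ _ eq))

    edgeColour-vertex : ∀ {u v c} → Adj u v → EdgeColour u v c → colour u u ↑ˡ 2 ≢ c
    edgeColour-vertex _ (forward _)  eq = ↑ˡ≢↑ʳ eq
    edgeColour-vertex _ (backward _) eq = ↑ˡ≢↑ʳ eq
    edgeColour-vertex p (chord _ _)  eq = TotalColouring.vertex≢edge base p (↑ˡ-injective 2 _ _ eq)

    recoloured : TotalColouring G (q + 2)
    recoloured = record
      { vertex        = λ u → colour u u ↑ˡ 2
      ; edge          = newEdge
      ; edge-sym      = λ {u} {v} _ → edgeColour-sym (proj₂ (edgeColour u v)) (proj₂ (edgeColour v u))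
      ; vertex≢vertex = λ p eq → TotalColouring.vertex≢vertex base p (↑ˡ-injective 2 _ _ eq)
      ; edge≢edge     = λ {u} {v} {w} p p′ v≢w →
          edgeColour-distinct p p′ v≢w (proj₂ (edgeColour u v)) (proj₂ (edgeColour u w))
      ; vertex≢edge   = λ {u} {v} p → edgeColour-vertex p (proj₂ (edgeColour u v))
      }

    -- Colour sums after the recolouring

    open TotalColouring recoloured using (colourSum)

    newEdge-next : ∀ u → newEdge u (next u) ≡ q ↑ʳ parity u
    newEdge-next u = edgeColour-sym (proj₂ (edgeColour u (next u))) (backward refl)

    newEdge-prev : ∀ u → newEdge u (prev u) ≡ q ↑ʳ parity (prev u)
    newEdge-prev u = edgeColour-sym (proj₂ (edgeColour u (prev u))) (forward (sym (next-prev u)))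

    newEdge-chord : ∀ {u v} → next u ≢ v → prev u ≢ v → newEdge u v ≡ colour u v ↑ˡ 2
    newEdge-chord {u} {v} next≢ prev≢ = trans
      (edgeColour-sym (proj₂ (edgeColour u v))
        (chord (λ u≡ → prev≢ (trans (cong prev u≡) (prev-next v))) (λ v≡ → next≢ (sym v≡))))
      (cong (_↑ˡ 2) (colour-comm v u))

    -- Isolates the two cycle edges at `u`. The list has no repetition, so every other neighbour is
    -- joined to `u` by a chord.
    neighbours↭ : ∀ u → ∃[ vs ] (neighbours u ↭ next u ∷ prev u ∷ vs
                                × All (λ v → newEdge u v ≡ colour u v ↑ˡ 2) vs)
    neighbours↭ u =
      let ws , p = ∈⇒↭∷ (adj⇒∈neighbours (adj-next u))
          vs , r = ∈⇒↭∷ (tail (∈-resp-↭ p (adj⇒∈neighbours (adj-prev u))))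
          perm   = ↭-trans p (prep (next u) r)
      in vs , perm , unchanged (Unique-resp-↭ perm (neighbours-unique u))
      where
      tail : ∀ {ws} → prev u ∈ next u ∷ ws → prev u ∈ ws
      tail (here eq)  = contradiction (sym eq) (next≢prev u)
      tail (there v∈) = v∈

      unchanged : ∀ {vs} → Unique (next u ∷ prev u ∷ vs) → All (λ v → newEdge u v ≡ colour u v ↑ˡ 2) vs
      unchanged ((_ ∷ next≢) ∷ (prev≢ ∷ _)) =
        All.zipWith (λ (next≢v , prev≢v) → newEdge-chord next≢v prev≢v) (next≢ , prev≢)

    distinct⇒sum≡1 : ∀ {i j : Fin 2} → i ≢ j → toℕ i + toℕ j ≡ 1
    distinct⇒sum≡1 {zero}     {zero}     i≢j = contradiction refl i≢j
    distinct⇒sum≡1 {zero}     {suc zero} _   = refl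
    distinct⇒sum≡1 {suc zero} {zero}     _   = refl
    distinct⇒sum≡1 {suc zero} {suc zero} i≢j = contradiction refl i≢j

    -- Indices rather than values suffice, as the extra 1 of each edge occurs before and after the
    -- exchange.
    removed : Fin n → ℕ
    removed u = toℕ (colour u (next u)) + toℕ (colour u (prev u))

    module _ {u : Fin n} {vs : List (Fin n)} (perm : neighbours u ↭ next u ∷ prev u ∷ vs)
             (unchanged : All (λ v → newEdge u v ≡ colour u v ↑ˡ 2) vs) where

      open ≡-Reasoning

      old new : Fin n → ℕ
      old v = suc (toℕ (colour u v))
      new v = suc (toℕ (newEdge u v))

      -- Here `c` is the value at the vertex, `x` and `y` are the old colours of the two cycle
      -- edges, `p` and `p′` the parities in the new ones, and `r` the sum over the chords.
      exchange : ∀ c x y p p′ r q → c + (suc (q + p) + (suc (q + p′) + r)) + (x + y) ≡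
                                    c + (suc x + (suc y + r)) + (q + q + (p + p′))
      exchange = ℕ.solve-∀

      new≡old : map new vs ≡ map old vs
      new≡old = map-cong-local
        (All.map (λ {v} eq → cong suc (trans (cong toℕ eq) (toℕ-↑ˡ (colour u v) 2))) unchanged)

      after : colourSum u ≡
              old u + (suc (q + toℕ (parity u)) + (suc (q + toℕ (parity (prev u))) + sum (map old vs)))
      after = cong₂ _+_ (cong suc (toℕ-↑ˡ (colour u u) 2)) (begin
        sum (map new (neighbours u))
          ≡⟨ sum-↭ (↭.map⁺ new perm) ⟩
        new (next u) + (new (prev u) + sum (map new vs))
          ≡⟨ cong₂ _+_ (cong suc (trans (cong toℕ (newEdge-next u)) (toℕ-↑ʳ q (parity u))))
               (cong₂ _+_ (cong suc (trans (cong toℕ (newEdge-prev u)) (toℕ-↑ʳ q (parity (prev u)))))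
                          (cong sum new≡old)) ⟩
        suc (q + toℕ (parity u)) + (suc (q + toℕ (parity (prev u))) + sum (map old vs)) ∎)

      -- The base colouring shows each colour exactly once at `u`, so its colour sum is independent
      -- of `u`.
      before : sum (map (λ i → suc (toℕ i)) (allFin q)) ≡
               old u + (old (next u) + (old (prev u) + sum (map old vs)))
      before = begin
        sum (map (λ i → suc (toℕ i)) (allFin q))
          ≡⟨ sum-↭ (↭.map⁺ (λ i → suc (toℕ i)) (colours↭allFin u)) ⟨
        sum (map (λ i → suc (toℕ i)) (map (colour u) (ball u)))
          ≡⟨ cong sum (map-∘ {g = λ i → suc (toℕ i)} {f = colour u} (ball u)) ⟨
        old u + sum (map old (neighbours u))
          ≡⟨ cong (λ r → old u + r) (sum-↭ (↭.map⁺ old perm)) ⟩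
        old u + (old (next u) + (old (prev u) + sum (map old vs))) ∎

      -- An addition avoids truncated subtraction. The two new edges have opposite parities, hence
      -- indices with sum `q + q + 1`.
      colourSum+removed : colourSum u + removed u ≡
                          sum (map (λ i → suc (toℕ i)) (allFin q)) + (q + q + 1)
      colourSum+removed = trans (cong (_+ removed u) after) (trans
        (exchange (old u) (toℕ (colour u (next u))) (toℕ (colour u (prev u)))
                  (toℕ (parity u)) (toℕ (parity (prev u))) (sum (map old vs)) q)
        (cong₂ (λ t p → t + (q + q + p)) (sym before)
               (distinct⇒sum≡1 (parity-distinct (sym (next-prev u))))))

    colourSum+removed-const : ∀ u → colourSum u + removed u ≡
                              sum (map (λ i → suc (toℕ i)) (allFin q)) + (q + q + 1)
    colourSum+removed-const u =
      let _ , perm , unchanged = neighbours↭ u in colourSum+removed perm unchanged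

    -- The offsets 1 and -1 cancel. The bracketing as a double of a double prepares two uses of
    -- `halve`.
    removed-mod : ∀ u → + removed u ≡ (⟦ u ⟧ ℤ.+ ⟦ u ⟧) ℤ.+ (⟦ u ⟧ ℤ.+ ⟦ u ⟧) [mod q ]
    removed-mod u = mod-trans (mod-+ (colour-mod (+ 1)) (colour-mod (ℤ.- (+ 1)))) (mod-reflexive (eq ⟦ u ⟧))
      where
      colour-mod : ∀ s → ⟦ colour u (rotate s u) ⟧ ≡ ⟦ u ⟧ ℤ.+ (⟦ u ⟧ ℤ.+ s) [mod q ]
      colour-mod s = mod-trans (residue-≡ q _) (mod-+ˡ ⟦ u ⟧ (mod-∣ q∣n (residue-≡ n (⟦ u ⟧ ℤ.+ s))))

      eq : ∀ a → a ℤ.+ (a ℤ.+ + 1) ℤ.+ (a ℤ.+ (a ℤ.+ ℤ.- (+ 1))) ≡ (a ℤ.+ a) ℤ.+ (a ℤ.+ a)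
      eq = solve-∀

    -- Equal colour sums force equal removed sums, so `4u ≡ 4v` and hence `u ≡ v` modulo the odd
    -- `q`; nearness then makes `u` and `v` equal.
    recoloured-distinguishing : NeighbourSumDistinguishing recoloured
    recoloured-distinguishing {u} {v} p sum≡ = adj⇒≢ p (near-injective (near-refl n k u) (adj⇒near p)
      (halve (+ k) +q≡ (halve (+ k) +q≡
        (mod-trans (mod-sym (removed-mod u)) (mod-trans (mod-reflexive (cong +_ removed≡)) (removed-mod v))))))
      where
      removed≡ : removed u ≡ removed v
      removed≡ = ℕ.+-cancelˡ-≡ (colourSum u) _ _ (trans (colourSum+removed-const u)
        (sym (trans (cong (_+ removed v) sum≡) (colourSum+removed-const v))))

theorem2p2 : (n k : ℕ) → 1 ≤ k → k < ⌊ n /2⌋ → 2 ∣ n → (2 * k + 1) ∣ n →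
    (∃[ m ] (IsEquitableTotalChromaticNumber (cyclePower n k) m
    × IsTotalChromaticNumber (cyclePower n k) m))
    × (∃[ s ] (IsSumDistinguishingTotalChromaticNumber (cyclePower n k) s
    × s ≤ 2 * k + 3))
    × 2 * k + 3 ≡ Δ (cyclePower n k) + 3
theorem2p2 n k 1≤k k<⌊n/2⌋ 2∣n q∣n =
    -- The degree bound holds for every total colouring, so `base` witnesses both minima.
    (q , ((base , base-equitable) , λ j (c , _) → q≤colours c) , (base , λ j c → q≤colours c))
  -- The search for the least `s` is bounded by the recolouring, which has `q + 2 = 2k + 3` colours.
  , (let s , isLeast , s≤q+2 = least (distinguishing? (cyclePower n k)) (recoloured , recoloured-distinguishing)
     in s , isLeast , ℕ.≤-trans s≤q+2 (ℕ.≤-reflexive (ℕ.+-assoc (2 * k) 1 2)))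
  , cong (_+ 3) (sym Δ≡2k)
  where
  -- Both halves of `n`, rounded down and up, are at least `k + 1`.
  bound : suc k + suc k ≤ n
  bound = ℕ.≤-trans
    (ℕ.+-mono-≤ k<⌊n/2⌋ (ℕ.≤-trans k<⌊n/2⌋ (ℕ.⌊n/2⌋≤⌈n/2⌉ n)))
    (ℕ.≤-reflexive (ℕ.⌊n/2⌋+⌈n/2⌉≡n n))

  open Colouring {n} {k} {{>-nonZero (ℕ.≤-trans (s≤s z≤n) bound)}} bound q∣n (cyclePower n k)
    (cyclePowerAdj⇒near n k) (near⇒cyclePowerAdj n k)
  open Distinguishing 1≤k 2∣n
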